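{- Let $m\ge 3$ be an integer and let $G$ be a finite, simple, undirected, connected graph that is $K_{1,m}$-free and has diameter $2$. Then \[ cc(G)\le c(G)+2m-2, \] where $c(G)$ is the cop number of $G$ (in the ordinary game of Cops and Robbers) and $cc(G)$ is the minimum number of cops that have a winning strategy in the game of Cops and Attacking Robbers on $G$.
   Context: All graphs are finite, connected, simple and undirected. A graph is $K_{1,m}$-free if it has no induced subgraph isomorphic to the star $K_{1,m}$ (so $K_{1,3}$-free means claw-free). Cops and Robbers: the game is played on a graph $G$ with full information by two players, one controlling a set of cops and the other a single robber. The cops first choose initial vertices (several cops may occupy the same vertex), and then the robber chooses an initial vertex. After that the cops and the robber move alternately, with the cops moving first. On the cops' turn each cop either moves to a neighbouring vertex or stays where she is (any subset of the cops may move). On the robber's turn he either moves to a neighbouring vertex or stays where he is. The cops win if after finitely many rounds some cop occupies the same vertex as the robber (a capture); the robber wins if he can avoid capture indefinitely. The cop number $c(G)$ is the minimum number of cops for which the cops have a winning strategy on $G$. Cops and Attacking Robbers: the rules are the same, except that on his turn the robber may attack a cop: if he moves to a neighbouring vertex on which a cop is present, one cop on that vertex is eliminated (removed from the game). If that vertex contains exactly one cop, she is removed, the robber is not captured by this move, and the game continues with the remaining cops. If it contains two or more cops, only one of them is eliminated, and a remaining cop on that vertex then captures the robber, so the cops win. The robber may not start the game on a vertex occupied by a cop. The parameter $cc(G)$ is the minimum number of cops for which the cops have a winning strategy on $G$ in this game. -}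

module Defs where

open import Data.Nat using (ℕ; zero; suc; _≤_)
open import Data.Fin using (Fin; zero; suc)
open import Data.List using (List; length)
open import Data.List.Membership.Propositional using (_∈_; _∉_)
open import Data.List.Relation.Binary.Pointwise using (Pointwise)
open import Data.List.Relation.Unary.Any using (_─_)
open import Data.Product using (Σ-syntax; ∃-syntax; _×_)
open import Function.Bundles using (_⇔_)
open import Function.Definitions using (Injective)
open import Relation.Binary.Construct.Closure.Reflexive using (ReflClosure)
open import Relation.Binary.Core using (Rel)
open import Relation.Binary.Definitions using (Decidable; Symmetric)
open import Relation.Binary.PropositionalEquality using (_≡_)
open import Level using (0ℓ)
open import Relation.Nullary using (¬_; yes; no)

record Graph (n : ℕ) : Set₁ where
  infix 4 _~_ _~?_
  field
    _~_      : Rel (Fin n) 0ℓ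
    _~?_     : Decidable _~_
    ~-sym    : Symmetric _~_
    ~-irrefl : ∀ {v} → ¬ (v ~ v)

Least : (ℕ → Set) → ℕ → Set
Least P k = P k × (∀ {j} → P j → k ≤ j)

module _ {n : ℕ} (G : Graph n) where
  open Graph G

  data Walk : ℕ → Fin n → Fin n → Set where
    []  : ∀ {u} → Walk zero u u
    _∷_ : ∀ {u v w ℓ} → u ~ v → Walk ℓ v w → Walk (suc ℓ) u w

  Connected : Set
  Connected = ∀ u v → ∃[ ℓ ] Walk ℓ u v

  IsDistance : Fin n → Fin n → ℕ → Set
  IsDistance u v = Least (λ ℓ → Walk ℓ u v)

  IsDiameter : ℕ → Set
  IsDiameter d = (∀ u v → ∃[ e ] (IsDistance u v e × e ≤ d))
               × (∃[ u ] ∃[ v ] IsDistance u v d)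

-- H is isomorphic to the subgraph of G induced by the image of f.
HasInduced : ∀ {k n} → Graph k → Graph n → Set
HasInduced {k} {n} H G =
  Σ[ f ∈ (Fin k → Fin n) ]
    (Injective _≡_ _≡_ f × (∀ u v → (u H.~ v) ⇔ (f u G.~ f v)))
  where
    module H = Graph H
    module G = Graph G

data StarAdj {m : ℕ} : Rel (Fin (suc m)) 0ℓ where
  centre-leaf : ∀ {i} → StarAdj zero (suc i)
  leaf-centre : ∀ {i} → StarAdj (suc i) zero

-- K_{1,m}, with centre zero
K₁ : ∀ m → Graph (suc m)
K₁ m = record
  { _~_      = StarAdj
  ; _~?_     = dec
  ; ~-sym    = λ { centre-leaf → leaf-centre ; leaf-centre → centre-leaf }
  ; ~-irrefl = λ ()
  }
  where
    dec : Decidable (StarAdj {m})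
    dec zero    zero    = no λ ()
    dec zero    (suc _) = yes centre-leaf
    dec (suc _) zero    = yes leaf-centre
    dec (suc _) (suc _) = no λ ()

K₁-Free : ∀ {n} → ℕ → Graph n → Set
K₁-Free m G = ¬ HasInduced (K₁ m) G

-- Whose move is next.
data Turn : Set where
  cops robber : Turn

-- A position is a turn, the list of the vertices of the cops still in the game
-- (one entry per cop, so repetitions matter) and the vertex of the robber.
-- An inhabitant of a winning type below is a winning strategy of the cops from
-- that position: a tree with a cop move at each of their turns and a branch for
-- every legal robber move at each of his. Being inductive, it is well-founded,
-- so every play that follows it ends in a capture after finitely many rounds.

module _ {n : ℕ} (G : Graph n) where
  open Graph G

  Step : Rel (Fin n) 0ℓ
  Step = ReflClosure _~_

  data Win : Turn → List (Fin n) → Fin n → Set where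
    captured   : ∀ {t C r} → r ∈ C → Win t C r
    copsMove   : ∀ {C C′ r} → Pointwise Step C C′ →
                 Win robber C′ r → Win cops C r
    robberMove : ∀ {C r} → (∀ r′ → Step r r′ → Win cops C r′) →
                 Win robber C r

  CopsWin : ℕ → Set
  CopsWin k = ∃[ C ] (length C ≡ k × (∀ r → Win cops C r))

  IsCopNumber : ℕ → Set
  IsCopNumber = Least CopsWin

  -- When the robber moves to an occupied vertex r′, the cop p found there is
  -- removed; if r′ still occurs in C ─ p, then captured applies. Cops on the
  -- same vertex are interchangeable, so it is harmless that p is arbitrary.
  data AttackWin : Turn → List (Fin n) → Fin n → Set where
    captured   : ∀ {t C r} → r ∈ C → AttackWin t C r
    copsMove   : ∀ {C C′ r} → Pointwise Step C C′ →
                 AttackWin robber C′ r → AttackWin cops C r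
    robberMove : ∀ {C r} →
                 (∀ r′ → Step r r′ → r′ ∉ C → AttackWin cops C r′) →
                 (∀ r′ → r ~ r′ → (p : r′ ∈ C) → AttackWin cops (C ─ p) r′) →
                 AttackWin robber C r

  AttackCopsWin : ℕ → Set
  AttackCopsWin k =
    ∃[ C ] (length C ≡ k × (∀ r → r ∉ C → AttackWin cops C r))

  IsAttackCopNumber : ℕ → Set
  IsAttackCopNumber = Least AttackCopsWin

{-# OPTIONS --safe #-}

-- c cops follow a winning strategy of the ordinary game, while m - 1 bodyguards
-- protect them. When the main cops have moved against a robber on r, call one of
-- them exposed if she is adjacent to r and no other main cop can reach her
-- vertex. The exposed cops form an independent set of neighbours of r, so there
-- are at most m - 1 of them. By diameter 2, each bodyguard can in one move get to
-- or next to a prescribed vertex, so every exposed cop obtains a bodyguard;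
-- conversely each bodyguard is protected by the main cop she was sent to. Hence
-- every attack is answered by a capture, no cop is ever really lost, and
-- m - 1 ≤ 2m - 2.
module Submission where

open import Defs
open import Data.Nat using (ℕ; suc; _+_; _*_; _∸_; _≤_; z≤n; s≤s)
open import Data.Nat.Properties
  using (module ≤-Reasoning; +-monoʳ-≤; *-monoʳ-≤; +-∸-assoc; *-suc; m≤n*m; ≮⇒≥)
open import Data.Fin using (Fin; zero; suc; inject≤)
open import Data.Fin.Properties using (inject≤-injective; _≟_)
open import Data.List using (List; []; _∷_; _++_; length; lookup; replicate)
open import Data.List.Properties using (length-++; length-replicate)
open import Data.List.Membership.Propositional using (_∈_; lose)
open import Data.List.Membership.Propositional.Properties using (∈-lookup)
open import Data.List.Relation.Binary.Pointwise using (Pointwise; []; _∷_)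
import Data.List.Relation.Binary.Pointwise as Pointwise
open import Data.List.Relation.Unary.All using (All; []; _∷_)
import Data.List.Relation.Unary.All as All
open import Data.List.Relation.Unary.AllPairs using (AllPairs; []; _∷_)
open import Data.List.Relation.Unary.Any using (Any; here; there; any?; _─_)
import Data.List.Relation.Unary.Any as Any
open import Data.List.Relation.Unary.Any.Properties using (++⁺ˡ; ++⁺ʳ)
open import Data.Product using (Σ-syntax; ∃-syntax; _×_; _,_)
open import Data.Sum using (_⊎_; inj₁; inj₂; map; map₁)
open import Function using (_∘_)
open import Function.Bundles using (mk⇔)
open import Level using (0ℓ)
open import Relation.Binary.Construct.Closure.Reflexive using (refl; [_])
import Relation.Binary.Construct.Closure.Reflexive.Properties as Reflexive
open import Relation.Binary.Core using (Rel)
open import Relation.Binary.Definitions using (Decidable; Symmetric)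
open import Relation.Binary.PropositionalEquality
  using (_≡_; _≢_; refl; sym; trans; cong; cong₂; subst)
open import Relation.Nullary using (¬_; yes; no; contradiction)

AllPairs-lookup : ∀ {A : Set} {R : Rel A 0ℓ} → Symmetric R → ∀ {xs} → AllPairs R xs →
                  ∀ i j → i ≢ j → R (lookup xs i) (lookup xs j)
AllPairs-lookup R-sym (_  ∷ _)   zero    zero    i≢j = contradiction refl i≢j
AllPairs-lookup R-sym (px ∷ _)   zero    (suc j) i≢j = All.lookup px (∈-lookup j)
AllPairs-lookup R-sym (px ∷ _)   (suc i) zero    i≢j = R-sym (All.lookup px (∈-lookup i))
AllPairs-lookup R-sym (_  ∷ pxs) (suc i) (suc j) i≢j =
  AllPairs-lookup R-sym pxs i j (i≢j ∘ cong suc)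

-- Separates an attack on a main cop from one on a bodyguard; in either case the other block stays
-- intact.
─-++ : ∀ {A : Set} {x : A} xs {ys} (p : x ∈ xs ++ ys) →
       (Σ[ q ∈ x ∈ xs ] ((xs ++ ys) ─ p) ≡ (xs ─ q) ++ ys) ⊎
       (Σ[ q ∈ x ∈ ys ] ((xs ++ ys) ─ p) ≡ xs ++ (ys ─ q))
─-++ []       p         = inj₂ (p , refl)
─-++ (_ ∷ _)  (here eq) = inj₁ (here eq , refl)
─-++ (x ∷ xs) (there p) with ─-++ xs p
... | inj₁ (q , eq) = inj₁ (there q , cong (x ∷_) eq)
... | inj₂ (q , eq) = inj₂ (q , cong (x ∷_) eq)

module _ {n : ℕ} (G : Graph n) where
  open Graph G

  infix 4 _⟶_
  _⟶_ : Rel (Fin n) 0ℓ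
  _⟶_ = Step G

  ⟶-sym : Symmetric _⟶_
  ⟶-sym = Reflexive.sym ~-sym

  _⟶?_ : Decidable _⟶_
  _⟶?_ = Reflexive.dec _≟_ _~?_

  -- Since `_⟶_` is reflexive, this also makes the entries distinct, as the leaves of a star must
  -- be.
  Independent : List (Fin n) → Set
  Independent = AllPairs (λ x y → ¬ (x ⟶ y))

  independent-neighbours⇒K₁ : ∀ {m r J} → m ≤ length J →
                              All (r ~_) J → Independent J → HasInduced (K₁ m) G
  independent-neighbours⇒K₁ {m} {r} {J} m≤∣J∣ r~J ind = f , inj , λ u v → mk⇔ (to u v) (from u v)
    where
    leaf : Fin m → Fin n
    leaf i = lookup J (inject≤ i m≤∣J∣)

    f : Fin (suc m) → Fin n
    f zero    = r
    f (suc i) = leaf i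

    r~leaf : ∀ i → r ~ leaf i
    r~leaf i = All.lookup r~J (∈-lookup (inject≤ i m≤∣J∣))

    leaves-apart : ∀ i j → i ≢ j → ¬ (leaf i ⟶ leaf j)
    leaves-apart i j i≢j =
      AllPairs-lookup (_∘ ⟶-sym) ind (inject≤ i m≤∣J∣) (inject≤ j m≤∣J∣)
        (i≢j ∘ inject≤-injective m≤∣J∣ m≤∣J∣ i j)

    inj : ∀ {u v} → f u ≡ f v → u ≡ v
    inj {zero}  {zero}  _  = refl
    inj {zero}  {suc j} eq = contradiction (subst (r ~_) (sym eq) (r~leaf j)) ~-irrefl
    inj {suc i} {zero}  eq = contradiction (subst (r ~_) eq (r~leaf i)) ~-irrefl
    inj {suc i} {suc j} eq with i ≟ j
    ... | yes i≡j = cong suc i≡j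
    ... | no  i≢j = contradiction (subst (leaf i ⟶_) eq refl) (leaves-apart i j i≢j)

    to : ∀ u v → StarAdj u v → f u ~ f v
    to zero    (suc j) centre-leaf = r~leaf j
    to (suc i) zero    leaf-centre = ~-sym (r~leaf i)

    from : ∀ u v → f u ~ f v → StarAdj u v
    from zero    zero    e = contradiction e ~-irrefl
    from zero    (suc _) _ = centre-leaf
    from (suc _) zero    _ = leaf-centre
    from (suc i) (suc j) e with i ≟ j
    ... | yes refl = contradiction e ~-irrefl
    ... | no  i≢j  = contradiction [ e ] (leaves-apart i j i≢j)

  -- The condition kept on the robber's turns: after any attack from `r`, some survivor in `C ─ p`
  -- can recapture at once.
  Guarded : Fin n → List (Fin n) → Set
  Guarded r C = ∀ {x} → r ~ x → (p : x ∈ C) → Any (_⟶ x) (C ─ p)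

  GuardedExcept : List (Fin n) → Fin n → List (Fin n) → Set
  GuardedExcept J r C = ∀ {x} → r ~ x → (p : x ∈ C) → Any (_⟶ x) (C ─ p) ⊎ x ∈ J

  -- Greedy along the list: a neighbour of `r` enters `J` only if no later cop reaches her. Members
  -- of `J` chosen from the tail are such later cops, which gives independence. A cop whom only
  -- earlier cops reach may still enter `J`; this is harmless.
  exposed : ∀ r C → ∃[ J ] (All (_∈ C) J × All (r ~_) J × Independent J × GuardedExcept J r C)
  exposed r []      = [] , [] , [] , [] , λ _ ()
  exposed r (x ∷ C) with exposed r C | r ~? x | any? (_⟶? x) C
  ... | J , J⊆C , r~J , ind , g | no r≁x | _ =
    J , All.map there J⊆C , r~J , ind , g′
    where
    g′ : GuardedExcept J r (x ∷ C)
    g′ r~y (here refl) = contradiction r~y r≁x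
    g′ r~y (there p)   = map₁ there (g r~y p)
  ... | J , J⊆C , r~J , ind , g | yes _ | yes z⟶x =
    J , All.map there J⊆C , r~J , ind , g′
    where
    g′ : GuardedExcept J r (x ∷ C)
    g′ r~y (here refl) = inj₁ z⟶x
    g′ r~y (there p)   = map₁ there (g r~y p)
  ... | J , J⊆C , r~J , ind , g | yes r~x | no ¬z⟶x =
    x ∷ J , here refl ∷ All.map there J⊆C , r~x ∷ r~J ,
    All.map (λ z∈C x⟶z → ¬z⟶x (lose z∈C (⟶-sym x⟶z))) J⊆C ∷ ind , g′
    where
    g′ : GuardedExcept (x ∷ J) r (x ∷ C)
    g′ r~y (here refl) = inj₂ (here refl)
    g′ r~y (there p)   = map there there (g r~y p)

  capturing-move : ∀ {C r} → Any (_⟶ r) C → ∃[ C′ ] (Pointwise _⟶_ C C′ × r ∈ C′)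
  capturing-move {_ ∷ C} {r} (here z⟶r) = r ∷ C , z⟶r ∷ Pointwise.refl refl , here refl
  capturing-move {z ∷ _}     (there p)  =
    let C′ , C⟶C′ , r∈C′ = capturing-move p in z ∷ C′ , refl ∷ C⟶C′ , there r∈C′

  -- The robber just stays put. Hence a winning main team is nonempty and offers spare bodyguards a
  -- target.
  no-cops-no-win : ∀ {t r} → ¬ Win G t [] r
  no-cops-no-win (copsMove [] w) = no-cops-no-win w
  no-cops-no-win (robberMove f)  = no-cops-no-win (f _ refl)

  -- `k` is the number of bodyguards, one less than the number of leaves of the forbidden star.
  module _ {k : ℕ} (free : K₁-Free (suc k) G)
           (midpoint : ∀ u v → ∃[ w ] (u ⟶ w × w ⟶ v)) where

    -- Bodyguards left over when J is exhausted must be protected as well, so they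
    -- are sent to an arbitrary main cop y.
    send-bodyguards : ∀ {M y} → y ∈ M → ∀ {J} → All (_∈ M) J → ∀ B → length J ≤ length B →
      ∃[ B′ ] (Pointwise _⟶_ B B′ × All (λ x → Any (_⟶ x) B′) J × All (λ b → Any (b ⟶_) M) B′)
    send-bodyguards y∈M []  []      _ = [] , [] , [] , []
    send-bodyguards {y = y} y∈M [] (b ∷ B) _ =
      let w , b⟶w , w⟶y          = midpoint b y
          B′ , B⟶B′ , _ , B′safe = send-bodyguards y∈M [] B z≤n
      in w ∷ B′ , b⟶w ∷ B⟶B′ , [] , lose y∈M w⟶y ∷ B′safe
    send-bodyguards y∈M {x ∷ _} (x∈M ∷ J⊆M) (b ∷ B) (s≤s ∣J∣≤∣B∣) =
      let w , b⟶w , w⟶x              = midpoint b x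
          B′ , B⟶B′ , Jsafe , B′safe = send-bodyguards y∈M J⊆M B ∣J∣≤∣B∣
      in w ∷ B′ , b⟶w ∷ B⟶B′ , here w⟶x ∷ All.map there Jsafe , lose x∈M w⟶x ∷ B′safe

    protect : ∀ r {M y} → y ∈ M → ∀ B → length B ≡ k →
              ∃[ B′ ] (Pointwise _⟶_ B B′ × Guarded r (M ++ B′))
    protect r {M} y∈M B ∣B∣≡k with exposed r M
    ... | J , J⊆M , r~J , ind , g with send-bodyguards y∈M J⊆M B ∣J∣≤∣B∣
      where
      ∣J∣≤∣B∣ : length J ≤ length B
      ∣J∣≤∣B∣ = subst (length J ≤_) (sym ∣B∣≡k)
        -- More than `k` exposed cops would be the leaves of an induced star centred at `r`.
        (≮⇒≥ λ k<∣J∣ → free (independent-neighbours⇒K₁ k<∣J∣ r~J ind))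
    ... | B′ , B⟶B′ , Jsafe , B′safe = B′ , B⟶B′ , guarded
      where
      guarded : Guarded r (M ++ B′)
      guarded r~x p with ─-++ M p
      -- A bodyguard was attacked: `M` is intact, and the main cop next to her or on her vertex
      -- recaptures.
      ... | inj₂ (q , eq) rewrite eq = ++⁺ˡ (Any.map ⟶-sym (All.lookup B′safe q))
      ... | inj₁ (q , eq) rewrite eq with g r~x q
      ...   | inj₁ z⟶x = ++⁺ˡ z⟶x
      ...   | inj₂ x∈J = ++⁺ʳ (M ─ q) (All.lookup Jsafe x∈J)

    -- Induction on the ordinary strategy tree. Moves to unoccupied vertices follow its branches,
    -- while an attack is answered by an immediate capture, so the induction never meets a reduced
    -- team. `B` is arbitrary on the cops' turn because the bodyguards are assigned afresh each
    -- round.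
    win⇒attackWin : ∀ {M r} → Win G cops M r → ∀ B → length B ≡ k → AttackWin G cops (M ++ B) r
    win⇒attackWin-robber : ∀ {M r} → Win G robber M r → ∀ B → length B ≡ k →
                           Guarded r (M ++ B) → AttackWin G robber (M ++ B) r

    win⇒attackWin (captured r∈M) B _ = captured (++⁺ˡ r∈M)
    win⇒attackWin (copsMove {C′ = []} _ w) B _ = contradiction w no-cops-no-win
    win⇒attackWin {r = r} (copsMove {C′ = _ ∷ _} M⟶M′ w) B ∣B∣≡k =
      let B′ , B⟶B′ , guarded = protect r (here refl) B ∣B∣≡k
          ∣B′∣≡k              = trans (sym (Pointwise.Pointwise-length B⟶B′)) ∣B∣≡k
      in copsMove (Pointwise.++⁺ M⟶M′ B⟶B′) (win⇒attackWin-robber w B′ ∣B′∣≡k guarded)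

    win⇒attackWin-robber (captured r∈M) B _ _ = captured (++⁺ˡ r∈M)
    win⇒attackWin-robber (robberMove f) B ∣B∣≡k guarded = robberMove
      (λ r′ r⟶r′ _ → win⇒attackWin (f r′ r⟶r′) B ∣B∣≡k)
      (λ r′ r~r′ p → let _ , C⟶C′ , r′∈C′ = capturing-move (guarded r~r′ p)
                     in copsMove C⟶C′ (captured r′∈C′))

    copsWin⇒attackCopsWin : Fin n → ∀ {c} → CopsWin G c → AttackCopsWin G (c + k)
    copsWin⇒attackCopsWin v (C , ∣C∣≡c , win) =
      C ++ replicate k v ,
      trans (length-++ C) (cong₂ _+_ ∣C∣≡c (length-replicate k)) ,
      -- The bodyguards may start anywhere, here all on `v`.
      λ r _ → win⇒attackWin (win r) (replicate k v) (length-replicate k)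

  diameter-2⇒midpoint : IsDiameter G 2 → ∀ u v → ∃[ w ] (u ⟶ w × w ⟶ v)
  diameter-2⇒midpoint (dist , _) u v with dist u v
  ... | _ , ([]          , _) , _ = u , refl , refl
  ... | _ , (e ∷ []      , _) , _ = u , refl , [ e ]
  ... | _ , (e ∷ e′ ∷ [] , _) , _ = _ , [ e ] , [ e′ ]
  ... | _ , (_ ∷ _ ∷ _ ∷ _ , _) , s≤s (s≤s ())

theorem10 : ∀ (m : ℕ) → 3 ≤ m →
    ∀ {n : ℕ} (G : Graph n) → Connected G → K₁-Free m G → IsDiameter G 2 →
    ∀ (c cc : ℕ) → IsCopNumber G c → IsAttackCopNumber G cc →
    cc ≤ c + 2 * m ∸ 2
theorem10 (suc k) _ G _ free diam@(_ , v , _) c cc (win , _) (_ , least) = begin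
  cc                      ≤⟨ least (copsWin⇒attackCopsWin G free (diameter-2⇒midpoint G diam) v win) ⟩
  c + k                   ≤⟨ +-monoʳ-≤ c (m≤n*m k 2) ⟩
  c + 2 * k               ≡⟨ cong (λ x → c + (x ∸ 2)) (*-suc 2 k) ⟨
  -- The bound parses as `(c + 2 * m) ∸ 2`, so regrouping the truncated subtraction needs
  -- `2 ≤ 2 * suc k`.
  c + (2 * suc k ∸ 2)     ≡⟨ +-∸-assoc c (*-monoʳ-≤ 2 (s≤s z≤n)) ⟨
  c + 2 * suc k ∸ 2       ∎
  where open ≤-Reasoning
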